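{- Let $\alpha\in[0,1)$ and let $G$ be a connected graph of order $n$ that is not transmission regular. Then \[ T_{\max}(G)-\mu_{\alpha}(G)>\frac{(1-\alpha)\,n\,T_{\max}(G)\,\bigl(nT_{\max}(G)-2\sigma(G)\bigr)}{(1-\alpha)\,n^2\,T_{\max}(G)+4\sigma(G)\bigl(nT_{\max}(G)-2\sigma(G)\bigr)}. \]
   Context: All graphs are finite, simple and undirected; $d_G(u,v)$ is the distance between $u$ and $v$ in the connected graph $G$. The transmission of a vertex $u$ is $T_G(u)=\sum_{v\in V(G)}d_G(u,v)$; $T_{\max}(G)$ is the maximum of $T_G(u)$ over all vertices $u$; $\sigma(G)=\frac12\sum_{v\in V(G)}T_G(v)$ is the sum of the distances over all unordered pairs of vertices. $G$ is transmission regular if $T_G(v)$ is the same for all $v\in V(G)$. Let $T(G)$ be the diagonal matrix of transmissions and $D(G)=(d_G(u,v))_{u,v\in V(G)}$ the distance matrix. For $\alpha\in[0,1)$, $D_{\alpha}(G)=\alpha T(G)+(1-\alpha)D(G)$, and $\mu_{\alpha}(G)$ (the distance $\alpha$-spectral radius) is the largest eigenvalue of the symmetric matrix $D_{\alpha}(G)$. -}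

module Defs where

open import Level using (_⊔_; 0ℓ) renaming (suc to lsuc)
open import Algebra.Apartness.Structures using (IsHeytingField)
open import Algebra.Bundles using (CommutativeRing)
open import Algebra.Core using (Op₁; Op₂)
import Algebra.Properties.CommutativeMonoid.Sum as Summation
import Algebra.Properties.Monoid.Mult as Multiple
open import Data.Bool.Base using (if_then_else_)
open import Data.Fin.Base using (Fin)
import Data.Fin.Base as Fin
import Data.Fin.Properties as Fin
open import Data.Nat.Base as ℕ using (ℕ; zero; suc)
import Data.Nat.Properties as ℕ
open import Data.Product.Base using (∃; ∃-syntax; Σ-syntax; _×_; _,_; proj₁; proj₂)
open import Data.Sum.Base using (_⊎_)
open import Data.Vec.Functional using (Vector; foldr)
open import Relation.Binary.Core using (Rel)
open import Relation.Binary.Definitions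
  using (Decidable; Irreflexive; Symmetric; tri<; tri≈; tri>)
open import Relation.Binary.PropositionalEquality
  using (_≡_; refl; sym; trans; cong; cong₂; subst; module ≡-Reasoning)
open import Relation.Binary.Structures using (IsStrictPartialOrder)
open import Relation.Nullary using (¬_; yes; no; does)
open import Relation.Nullary.Decidable using (map′; _×-dec_; dec-true; dec-false)
import Relation.Unary as U

-- The library has no real numbers, so ℝ is given by its axioms: an
-- Archimedean, Cauchy-complete ordered field.  Classically such a field is
-- isomorphic to ℝ, and in the form below the axioms are also satisfied by the
-- constructive (Bishop) reals, so they do not presuppose excluded middle.
record Reals c ℓ₁ ℓ₂ : Set (lsuc (c ⊔ ℓ₁ ⊔ ℓ₂)) where
  infix  8 -_
  infixl 7 _*_
  infixl 6 _+_
  infix  4 _≈_ _<_ _#_ _≤_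
  field
    Carrier : Set c
    _≈_     : Rel Carrier ℓ₁
    _<_     : Rel Carrier ℓ₂
    _+_     : Op₂ Carrier
    _*_     : Op₂ Carrier
    -_      : Op₁ Carrier
    0#      : Carrier
    1#      : Carrier

  -- Constructive form of x ≠ y; the invertible numbers are those apart from 0#.
  _#_ : Rel Carrier ℓ₂
  x # y = x < y ⊎ y < x

  _≤_ : Rel Carrier ℓ₂
  x ≤ y = ¬ (y < x)

  field
    isHeytingField       : IsHeytingField _≈_ _#_ _+_ _*_ -_ 0# 1#
    isStrictPartialOrder : IsStrictPartialOrder _≈_ _<_
    +-monoˡ-<            : ∀ {x y} z → x < y → x + z < y + z
    *-pos                : ∀ {x y} → 0# < x → 0# < y → 0# < x * y

  open IsHeytingField isHeytingField public

  commutativeRing : CommutativeRing c ℓ₁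
  commutativeRing = record { isCommutativeRing = isCommutativeRing }

  open Summation (CommutativeRing.+-commutativeMonoid commutativeRing) public
    using (sum)
  open Multiple (CommutativeRing.+-monoid commutativeRing) public
    using () renaming (_×_ to _·_)

  fromℕ : ℕ → Carrier
  fromℕ n = n · 1#

  Within : Carrier → Rel Carrier ℓ₂
  Within ε x y = (x - y < ε) × (y - x < ε)

  IsCauchy : (ℕ → Carrier) → Set (c ⊔ ℓ₂)
  IsCauchy s = ∀ ε → 0# < ε →
    ∃[ N ] (∀ m n → N ℕ.≤ m → N ℕ.≤ n → Within ε (s m) (s n))

  ConvergesTo : (ℕ → Carrier) → Carrier → Set (c ⊔ ℓ₂)
  ConvergesTo s l = ∀ ε → 0# < ε → ∃[ N ] (∀ n → N ℕ.≤ n → Within ε (s n) l)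

  field
    archimedean : ∀ x → ∃[ n ] (x < fromℕ n)
    complete    : ∀ s → IsCauchy s → ∃[ l ] ConvergesTo s l

  -- The inverse in the library is that of y - 0#, which equals that of y.
  divide : (x y : Carrier) → y # 0# → Carrier
  divide x y y#0 = x * proj₁ (#⇒invertible y#0)

record Graph (n : ℕ) : Set₁ where
  field
    Adj    : Rel (Fin n) 0ℓ
    adj?   : Decidable Adj
    irrefl : Irreflexive _≡_ Adj
    symm   : Symmetric Adj

module _ {n : ℕ} (G : Graph n) where
  open Graph G

  data Walk : Fin n → Fin n → ℕ → Set where
    []  : ∀ {u} → Walk u u 0
    _∷_ : ∀ {u v w k} → Adj u v → Walk v w k → Walk u w (suc k)

  Connected : Set
  Connected = ∀ u v → ∃[ k ] Walk u v k

  walk? : ∀ u v → U.Decidable (Walk u v)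
  walk? u v zero = map′ (λ { refl → [] }) (λ { [] → refl }) (u Fin.≟ v)
  walk? u v (suc k) =
    map′ (λ (_ , a , p) → a ∷ p) (λ { (a ∷ p) → _ , a , p })
         (Fin.any? (λ w → adj? u w ×-dec walk? w v k))

IsLeast : (ℕ → Set) → ℕ → Set
IsLeast P k = P k × (∀ j → P j → k ℕ.≤ j)

least : ∀ {P : ℕ → Set} → U.Decidable P → ∃ P → ∃ (IsLeast P)
least {P} P? (k , pk) = go k 0 (subst P (sym (ℕ.+-identityʳ k)) pk) (λ _ _ → ℕ.z≤n)
  where
  go : ∀ fuel i → P (fuel ℕ.+ i) → (∀ j → P j → i ℕ.≤ j) → ∃ (IsLeast P)
  go zero    i p below = i , p , below
  go (suc f) i p below with P? i
  ... | yes pi = i , pi , below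
  ... | no ¬pi = go f (suc i) (subst P (sym (ℕ.+-suc f i)) p)
                   (λ j pj → ℕ.≤∧≢⇒< (below j pj) (λ { refl → ¬pi pj }))

module _ {n : ℕ} (G : Graph n) (conn : Connected G) where

  -- A shortest walk repeats no vertex, so this is the length of a shortest path.
  dist : Fin n → Fin n → ℕ
  dist u v = proj₁ (least (walk? G u v) (conn u v))

  dist-isLeast : ∀ u v → IsLeast (Walk G u v) (dist u v)
  dist-isLeast u v = proj₂ (least (walk? G u v) (conn u v))

  private
    open module ℕΣ = Summation ℕ.+-0-commutativeMonoid using (sum)

  transmission : Vector ℕ n
  transmission u = sum (λ v → dist u v)

  Tmax : ℕ
  Tmax = foldr ℕ._⊔_ 0 transmission

  σ : ℕ
  σ = sum (λ u → sum (λ v → if does (u Fin.<? v) then dist u v else 0))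

  TransmissionRegular : Set
  TransmissionRegular = ∀ u v → transmission u ≡ transmission v

  private
    snoc : ∀ {u v w k} → Walk G u v k → Graph.Adj G v w → Walk G u w (suc k)
    snoc []      b = b ∷ []
    snoc (a ∷ p) b = a ∷ snoc p b

    reverse : ∀ {u v k} → Walk G u v k → Walk G v u k
    reverse []      = []
    reverse (a ∷ p) = snoc (reverse p) (Graph.symm G a)

  dist-sym : ∀ u v → dist u v ≡ dist v u
  dist-sym u v = ℕ.≤-antisym (half u v) (half v u)
    where
    half : ∀ u v → dist u v ℕ.≤ dist v u
    half u v = proj₂ (dist-isLeast u v) _ (reverse (proj₁ (dist-isLeast v u)))

  dist-refl : ∀ u → dist u u ≡ 0
  dist-refl u = ℕ.n≤0⇒n≡0 (proj₂ (dist-isLeast u u) 0 [])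

  -- σ, summed over unordered pairs, is half the sum of the transmissions.
  σ+σ≡∑transmission : σ ℕ.+ σ ≡ sum transmission
  σ+σ≡∑transmission = begin
    σ ℕ.+ σ
      ≡⟨ cong (σ ℕ.+_) (ℕΣ.∑-comm lt) ⟩
    σ ℕ.+ sum (λ v → sum (λ u → lt u v))
      ≡⟨ ℕΣ.∑-distrib-+ (λ u → sum (lt u)) (λ v → sum (λ u → lt u v)) ⟨
    sum (λ u → sum (lt u) ℕ.+ sum (λ v → lt v u))
      ≡⟨ ℕΣ.sum-cong-≗ (λ u → ℕΣ.∑-distrib-+ (lt u) (λ v → lt v u)) ⟨
    sum (λ u → sum (λ v → lt u v ℕ.+ lt v u))
      ≡⟨ ℕΣ.sum-cong-≗ (λ u → ℕΣ.sum-cong-≗ (λ v → split u v)) ⟩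
    sum transmission ∎
    where
    open ≡-Reasoning
    lt : Fin n → Fin n → ℕ
    lt u v = if does (u Fin.<? v) then dist u v else 0

    on : ∀ {u v} → u Fin.< v → lt u v ≡ dist u v
    on {u} {v} u<v rewrite dec-true (u Fin.<? v) u<v = refl

    off : ∀ {u v} → ¬ (u Fin.< v) → lt u v ≡ 0
    off {u} {v} u≮v rewrite dec-false (u Fin.<? v) u≮v = refl

    split : ∀ u v → lt u v ℕ.+ lt v u ≡ dist u v
    split u v with Fin.<-cmp u v
    ... | tri< u<v _ v≮u = trans (cong₂ ℕ._+_ (on u<v) (off v≮u)) (ℕ.+-identityʳ _)
    ... | tri≈ u≮v refl _ = trans (cong₂ ℕ._+_ (off u≮v) (off u≮v)) (sym (dist-refl u))
    ... | tri> u≮v _ v<u = trans (cong₂ ℕ._+_ (off u≮v) (on v<u)) (dist-sym v u)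

module _ {c ℓ₁ ℓ₂} (R : Reals c ℓ₁ ℓ₂) where
  open Reals R hiding (refl; sym; trans)

  Matrix : ℕ → Set c
  Matrix n = Fin n → Fin n → Carrier

  diagonal : ∀ {n} → Vector Carrier n → Matrix n
  diagonal t i j = if does (i Fin.≟ j) then t i else 0#

  IsEigenvalue : ∀ {n} → Matrix n → Carrier → Set (c ⊔ ℓ₁ ⊔ ℓ₂)
  IsEigenvalue {n} M μ = Σ[ x ∈ Vector Carrier n ]
    ((∃[ i ] (x i # 0#)) × (∀ i → sum (λ j → M i j * x j) ≈ μ * x i))

  IsLargestEigenvalue : ∀ {n} → Matrix n → Carrier → Set (c ⊔ ℓ₁ ⊔ ℓ₂)
  IsLargestEigenvalue M μ = IsEigenvalue M μ × (∀ ν → IsEigenvalue M ν → ν ≤ μ)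

  module _ {n : ℕ} (G : Graph n) (conn : Connected G) where

    transmissionMatrix : Matrix n
    transmissionMatrix = diagonal (λ u → fromℕ (transmission G conn u))

    distanceMatrix : Matrix n
    distanceMatrix u v = fromℕ (dist G conn u v)

    D[_] : Carrier → Matrix n
    D[ α ] u v = α * transmissionMatrix u v + (1# - α) * distanceMatrix u v

    IsSpectralRadius : (α μ : Carrier) → Set (c ⊔ ℓ₁ ⊔ ℓ₂)
    IsSpectralRadius α μ = IsLargestEigenvalue D[ α ] μ

{-# OPTIONS --safe #-}

-- For an eigenvector x put Q = Σ (T_max − T_u) x_u², P = Σ T_u x_u² and
-- E = Σ_{u,v} d(u,v) (x_u − x_v)².  Then T_max ∥x∥² = Q + P and
-- 2 (T_max − μ) ∥x∥² = 2 Q + (1 − α) E.  Let b and y be the entries of largest and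
-- smallest absolute value and K = n T_max − 2σ.  Then Q ≥ K y², P ≤ 2σ b² and
-- E ≥ n (b − y)² (already for the complete graph).  After clearing denominators these
-- estimates leave an excess A q² + C (b − y)² with A, C > 0 and q a linear form in b and y;
-- since q and b − y vanish together only if b = 0, the excess is at least a positive
-- multiple of b² ≥ ∥x∥² / n.
-- The entries b and y exist only up to double negation, but this suffices for the
-- quantitative bound, because ≤ is a negation; the strict inequality follows from it.
module Submission where

open import Defs
open import Algebra.Bundles using (CommutativeRing)
open import Algebra.Solver.Ring.AlmostCommutativeRing using (fromCommutativeRing; _-Raw-AlmostCommutative⟶_)
open import Algebra.Apartness.Bundles using (HeytingCommutativeRing)
import Algebra.Apartness.Properties.HeytingCommutativeRing as HeytingProperties
import Algebra.Properties.AbelianGroup as AbelianGroupProperties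
import Algebra.Properties.CommutativeMonoid.Sum as CommutativeMonoidSum
import Algebra.Properties.Ring as RingProperties
import Algebra.Properties.Semiring.Mult as MultProperties
import Algebra.Properties.Semiring.Sum as SumProperties
import Algebra.Solver.Ring as RingSolver
open import Data.Fin.Base using (Fin; zero; suc)
import Data.Fin.Properties as Fin
open import Data.Integer.Base as ℤ using (ℤ; +_; -[1+_])
import Data.Integer.Properties as ℤ
open import Data.Maybe.Base as Maybe using ()
open import Data.Nat.Base as ℕ using (ℕ; zero; suc)
import Data.Nat.Properties as ℕ
open import Data.Product.Base using (Σ-syntax; ∃-syntax; _×_; _,_; proj₁; proj₂)
import Data.Sign.Base as Sign
open import Data.Sum.Base using (_⊎_; inj₁; inj₂; [_,_]′)
open import Data.Vec.Functional using (Vector; foldr)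
open import Function.Base using (_∘_)
open import Relation.Binary.PropositionalEquality as ≡ using (_≡_; _≢_)
import Relation.Binary.Reasoning.Setoid as SetoidReasoning
open import Relation.Binary.Structures using (IsStrictPartialOrder)
open import Relation.Nullary using (¬_; yes; no; contradiction)
open import Relation.Nullary.Decidable using (dec⇒maybe; dec-true; dec-false; ¬¬-excluded-middle)

-- A ring solver with integer coefficients.

module IntegerSolver {c ℓ} (CR : CommutativeRing c ℓ) where
  open CommutativeRing CR
  open MultProperties semiring renaming (_×_ to _·_)
  open RingProperties ring using (-0#≈0#; -‿involutive; -‿distribˡ-*; -‿distribʳ-*)
  open AbelianGroupProperties +-abelianGroup using (⁻¹-∙-comm)
  open SetoidReasoning setoid

  -- Definitionally equal to fromℕ n on + n, so that con (+ n) matches the numerals in the statements.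
  ⟦_⟧ℤ : ℤ → Carrier
  ⟦ + n ⟧ℤ      = n · 1#
  ⟦ -[1+ n ] ⟧ℤ = - (suc n · 1#)

  private
    ⊖-homo : ∀ m n → ⟦ m ℤ.⊖ n ⟧ℤ ≈ m · 1# - n · 1#
    ⊖-homo zero    zero    = sym (-‿inverseʳ 0#)
    ⊖-homo zero    (suc n) = sym (+-identityˡ _)
    ⊖-homo (suc m) zero    = sym (trans (+-congˡ -0#≈0#) (+-identityʳ _))
    ⊖-homo (suc m) (suc n) = begin
      ⟦ suc m ℤ.⊖ suc n ⟧ℤ                  ≡⟨ ≡.cong ⟦_⟧ℤ (ℤ.[1+m]⊖[1+n]≡m⊖n m n) ⟩
      ⟦ m ℤ.⊖ n ⟧ℤ                          ≈⟨ ⊖-homo m n ⟩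
      m · 1# - n · 1#                       ≈⟨ +-congʳ (+-identityʳ _) ⟨
      m · 1# + 0# - n · 1#                  ≈⟨ +-congʳ (+-congˡ (-‿inverseʳ 1#)) ⟨
      m · 1# + (1# - 1#) - n · 1#           ≈⟨ +-congʳ (+-assoc _ _ _) ⟨
      m · 1# + 1# - 1# - n · 1#             ≈⟨ +-assoc _ _ _ ⟩
      m · 1# + 1# + (- 1# - n · 1#)         ≈⟨ +-cong (+-comm _ _) (⁻¹-∙-comm _ _) ⟩
      1# + m · 1# - (1# + n · 1#)           ∎

    +◃-homo : ∀ n → ⟦ Sign.+ ℤ.◃ n ⟧ℤ ≈ n · 1#
    +◃-homo zero    = refl
    +◃-homo (suc n) = refl

    -◃-homo : ∀ n → ⟦ Sign.- ℤ.◃ n ⟧ℤ ≈ - (n · 1#)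
    -◃-homo zero    = sym -0#≈0#
    -◃-homo (suc n) = refl

    +-homo : ∀ i j → ⟦ i ℤ.+ j ⟧ℤ ≈ ⟦ i ⟧ℤ + ⟦ j ⟧ℤ
    +-homo (+ m)    (+ n)    = ×-homo-+ 1# m n
    +-homo (+ m)    -[1+ n ] = ⊖-homo m (suc n)
    +-homo -[1+ m ] (+ n)    = trans (⊖-homo n (suc m)) (+-comm _ _)
    +-homo -[1+ m ] -[1+ n ] = begin
      - (suc (suc (m ℕ.+ n)) · 1#)        ≡⟨ ≡.cong (λ k → - (suc k · 1#)) (ℕ.+-suc m n) ⟨
      - ((suc m ℕ.+ suc n) · 1#)          ≈⟨ -‿cong (×-homo-+ 1# (suc m) (suc n)) ⟩
      - (suc m · 1# + suc n · 1#)         ≈⟨ ⁻¹-∙-comm _ _ ⟨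
      - (suc m · 1#) - suc n · 1#         ∎

    *-homo : ∀ i j → ⟦ i ℤ.* j ⟧ℤ ≈ ⟦ i ⟧ℤ * ⟦ j ⟧ℤ
    *-homo (+ m)    (+ n)    = trans (+◃-homo (m ℕ.* n)) (×1-homo-* m n)
    *-homo (+ m)    -[1+ n ] = begin
      ⟦ Sign.- ℤ.◃ (m ℕ.* suc n) ⟧ℤ       ≈⟨ -◃-homo (m ℕ.* suc n) ⟩
      - ((m ℕ.* suc n) · 1#)              ≈⟨ -‿cong (×1-homo-* m (suc n)) ⟩
      - (m · 1# * suc n · 1#)             ≈⟨ -‿distribʳ-* _ _ ⟩
      m · 1# * - (suc n · 1#)             ∎
    *-homo -[1+ m ] (+ n)    = begin
      ⟦ Sign.- ℤ.◃ (suc m ℕ.* n) ⟧ℤ       ≈⟨ -◃-homo (suc m ℕ.* n) ⟩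
      - ((suc m ℕ.* n) · 1#)              ≈⟨ -‿cong (×1-homo-* (suc m) n) ⟩
      - (suc m · 1# * n · 1#)             ≈⟨ -‿distribˡ-* _ _ ⟩
      - (suc m · 1#) * n · 1#             ∎
    *-homo -[1+ m ] -[1+ n ] = begin
      (suc m ℕ.* suc n) · 1#              ≈⟨ ×1-homo-* (suc m) (suc n) ⟩
      suc m · 1# * suc n · 1#             ≈⟨ -‿involutive _ ⟨
      - - (suc m · 1# * suc n · 1#)       ≈⟨ -‿cong (-‿distribʳ-* _ _) ⟩
      - (suc m · 1# * - (suc n · 1#))     ≈⟨ -‿distribˡ-* _ _ ⟩
      - (suc m · 1#) * - (suc n · 1#)     ∎

    -‿homo : ∀ i → ⟦ ℤ.- i ⟧ℤ ≈ - ⟦ i ⟧ℤ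
    -‿homo (+ zero)  = sym -0#≈0#
    -‿homo (+ suc n) = refl
    -‿homo -[1+ n ]  = sym (-‿involutive _)

    morphism : ℤ.+-*-rawRing -Raw-AlmostCommutative⟶ fromCommutativeRing CR
    morphism = record
      { ⟦_⟧    = ⟦_⟧ℤ
      ; +-homo = +-homo
      ; *-homo = *-homo
      ; -‿homo = -‿homo
      ; 0-homo = refl
      ; 1-homo = +-identityʳ 1#
      }

  -- Normalisation needs a test for equal coefficients; equality is decidable on integers, but in
  -- general not in the ring.
  open RingSolver ℤ.+-*-rawRing (fromCommutativeRing CR) morphism
    (λ i j → Maybe.map (reflexive ∘ ≡.cong ⟦_⟧ℤ) (dec⇒maybe (i ℤ.≟ j)))
    public using (solve; con; _:=_; _:+_; _:*_; _:-_; :-_)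

-- Order and arithmetic of the reals without excluded middle.

module RealProperties {c ℓ₁ ℓ₂} (R : Reals c ℓ₁ ℓ₂) where
  open Reals R public renaming (zero to *-zero)
  open CommutativeRing commutativeRing public using (semiring)
  open IsStrictPartialOrder isStrictPartialOrder public using ()
    renaming (irrefl to <-irrefl; trans to <-trans; <-respʳ-≈ to <-respʳ; <-respˡ-≈ to <-respˡ; asym to <-asym)

  heytingCommutativeRing : HeytingCommutativeRing c ℓ₁ ℓ₂
  heytingCommutativeRing = record { isHeytingCommutativeRing = isHeytingCommutativeRing }

  open HeytingProperties heytingCommutativeRing public
    using (1#0; invertibleˡ⇒#; x-0≈x)
  open IntegerSolver commutativeRing public
  open SumProperties semiring public
    using (sum-cong-≋; ∑-distrib-+; ∑-comm; *-distribˡ-sum; *-distribʳ-sum)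
  open MultProperties semiring public using (×-homo-+)
  module ≈-Reasoning = SetoidReasoning setoid

  private variable
    x y z w : Carrier

  -- Cotransitivity of apartness does not fix the direction. In the two unwanted cases `z` lies
  -- outside the interval, and transitivity through the nearer endpoint gives one of the
  -- alternatives.
  <-cotrans : x < y → ∀ z → x < z ⊎ z < y
  <-cotrans x<y z with #-cotrans (inj₁ x<y) z
  ... | inj₁ (inj₁ x<z) = inj₁ x<z
  ... | inj₁ (inj₂ z<x) = inj₂ (<-trans z<x x<y)
  ... | inj₂ (inj₁ z<y) = inj₂ z<y
  ... | inj₂ (inj₂ y<z) = inj₁ (<-trans x<y y<z)

  <-≤-trans : x < y → y ≤ z → x < z
  <-≤-trans {z = z} x<y y≤z with <-cotrans x<y z
  ... | inj₁ x<z = x<z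
  ... | inj₂ z<y = contradiction z<y y≤z

  ≤-trans : x ≤ y → y ≤ z → x ≤ z
  ≤-trans x≤y y≤z z<x = y≤z (<-≤-trans z<x x≤y)

  <⇒≤ : x < y → x ≤ y
  <⇒≤ x<y y<x = <-asym x<y y<x

  ≤-reflexive : x ≈ y → x ≤ y
  ≤-reflexive x≈y y<x = <-irrefl (sym x≈y) y<x

  ≤-respʳ : y ≈ z → x ≤ y → x ≤ z
  ≤-respʳ y≈z x≤y z<x = x≤y (<-respˡ (sym y≈z) z<x)

  ≤-respˡ : x ≈ y → x ≤ z → y ≤ z
  ≤-respˡ x≈y x≤z z<y = x≤z (<-respʳ (sym x≈y) z<y)

  -- Refuting both strict cases yields equality by tightness. A split into three cases is therefore
  -- legitimate when the goal is a negation, in particular when it is an instance of `≤`.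
  trichotomy-stable : ∀ {p} {P : Set p} → (x < y → ¬ P) → (x ≈ y → ¬ P) → (y < x → ¬ P) → ¬ P
  trichotomy-stable {x} {y} lt eq gt p =
    eq (proj₁ (tight x y) [ (λ x<y → lt x<y p) , (λ y<x → gt y<x p) ]′) p

  0<y-x⇒x<y : 0# < y - x → x < y
  0<y-x⇒x<y {y} {x} 0<y-x = <-respʳ (solve 2 (λ x y → y :- x :+ x := y) refl x y)
    (<-respˡ (+-identityˡ x) (+-monoˡ-< x 0<y-x))

  x<y⇒0<y-x : x < y → 0# < y - x
  x<y⇒0<y-x {x} x<y = <-respˡ (-‿inverseʳ x) (+-monoˡ-< (- x) x<y)

  x≤y⇒0≤y-x : x ≤ y → 0# ≤ y - x
  x≤y⇒0≤y-x {x} {y} x≤y lt = x≤y (<-respˡ (solve 2 (λ x y → y :- x :+ x := y) refl x y)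
    (<-respʳ (+-identityˡ x) (+-monoˡ-< x lt)))

  0≤y-x⇒x≤y : 0# ≤ y - x → x ≤ y
  0≤y-x⇒x≤y {y} {x} 0≤y-x y<x = 0≤y-x (<-respʳ (-‿inverseʳ x) (+-monoˡ-< (- x) y<x))

  neg⇒pos : x < 0# → 0# < - x
  neg⇒pos {x} x<0 = <-respʳ (+-identityˡ (- x)) (x<y⇒0<y-x x<0)

  pos+nonneg : 0# < x → 0# ≤ y → 0# < x + y
  pos+nonneg {x} {y} 0<x 0≤y = <-≤-trans 0<x
    (0≤y-x⇒x≤y (≤-respʳ (solve 2 (λ x y → y := x :+ y :- x) refl x y) 0≤y))

  +-nonneg : 0# ≤ x → 0# ≤ y → 0# ≤ x + y
  +-nonneg {x} {y} 0≤x 0≤y = ≤-trans 0≤x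
    (0≤y-x⇒x≤y (≤-respʳ (solve 2 (λ x y → y := x :+ y :- x) refl x y) 0≤y))

  +-pos : 0# < x → 0# < y → 0# < x + y
  +-pos 0<x 0<y = pos+nonneg 0<x (<⇒≤ 0<y)

  *-pos-neg : 0# < x → y < 0# → x * y < 0#
  *-pos-neg {x} {y} 0<x y<0 = 0<y-x⇒x<y
    (<-respʳ (solve 2 (λ x y → x :* :- y := con (+ 0) :- x :* y) refl x y) (*-pos 0<x (neg⇒pos y<0)))

  *-nonneg : 0# ≤ x → 0# ≤ y → 0# ≤ x * y
  *-nonneg {x} {y} 0≤x 0≤y = trichotomy-stable {0#} {x}
    (λ 0<x → trichotomy-stable {0#} {y}
      (λ 0<y → <⇒≤ (*-pos 0<x 0<y))
      (λ 0≈y → ≤-reflexive (trans (sym (zeroʳ x)) (*-congˡ 0≈y)))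
      (λ y<0 → contradiction y<0 0≤y))
    (λ 0≈x → ≤-reflexive (trans (sym (zeroˡ y)) (*-congʳ 0≈x)))
    (λ x<0 → contradiction x<0 0≤x)

  +-mono-≤ : x ≤ y → z ≤ w → x + z ≤ y + w
  +-mono-≤ {x} {y} {z} {w} x≤y z≤w = 0≤y-x⇒x≤y (≤-respʳ
    (solve 4 (λ x y z w → y :- x :+ (w :- z) := y :+ w :- (x :+ z)) refl x y z w)
    (+-nonneg (x≤y⇒0≤y-x x≤y) (x≤y⇒0≤y-x z≤w)))

  *-monoˡ-≤ : 0# ≤ z → x ≤ y → z * x ≤ z * y
  *-monoˡ-≤ {z} {x} {y} 0≤z x≤y = 0≤y-x⇒x≤y (≤-respʳ
    (solve 3 (λ x y z → z :* (y :- x) := z :* y :- z :* x) refl x y z)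
    (*-nonneg 0≤z (x≤y⇒0≤y-x x≤y)))

  *-monoʳ-≤ : 0# ≤ z → x ≤ y → x * z ≤ y * z
  *-monoʳ-≤ {z} {x} {y} 0≤z x≤y = ≤-respˡ (*-comm z x) (≤-respʳ (*-comm z y) (*-monoˡ-≤ 0≤z x≤y))

  #⇒square-pos : x # 0# → 0# < x * x
  #⇒square-pos {x} (inj₁ x<0) = <-respʳ (solve 1 (λ x → :- x :* :- x := x :* x) refl x)
    (*-pos (neg⇒pos x<0) (neg⇒pos x<0))
  #⇒square-pos (inj₂ 0<x) = *-pos 0<x 0<x

  square-nonneg : ∀ x → 0# ≤ x * x
  square-nonneg x = trichotomy-stable {x} {0#}
    (λ x<0 → <⇒≤ (#⇒square-pos (inj₁ x<0)))
    (λ x≈0 → ≤-reflexive (trans (sym (zeroʳ x)) (*-congˡ (sym x≈0))))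
    (λ 0<x → <⇒≤ (#⇒square-pos (inj₂ 0<x)))

  0<1 : 0# < 1#
  0<1 = <-respʳ (*-identityˡ 1#) (#⇒square-pos 1#0)

  -- The product is apart from 0, hence invertible, so `y` is invertible as well and thus apart from
  -- 0. Only its sign remains to be settled, and a negative `y` would make the product negative.
  *-cancelˡ-pos : 0# < x → 0# < x * y → 0# < y
  *-cancelˡ-pos {x} {y} 0<x 0<xy with #⇒invertible {x * y} {0#} (inj₂ 0<xy)
  ... | i , i*xy≈1 , _ = [ (λ y<0 → contradiction 0<xy (<⇒≤ (*-pos-neg 0<x y<0))) , (λ 0<y → 0<y) ]′
    (invertibleˡ⇒# {y} {0#} (i * x , trans (solve 3 (λ i x y → i :* x :* (y :- con (+ 0)) := i :* (x :* y :- con (+ 0))) refl i x y) i*xy≈1))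

  *-cancelˡ-nonneg : 0# < x → 0# ≤ x * y → 0# ≤ y
  *-cancelˡ-nonneg 0<x 0≤xy y<0 = 0≤xy (*-pos-neg 0<x y<0)

  divide-< : ∀ x y (y#0 : y # 0#) → 0# < y → ∀ z → 0# < y * z - x → divide x y y#0 < z
  divide-< x y y#0 0<y z 0<yz-x = 0<y-x⇒x<y (*-cancelˡ-pos 0<y (<-respʳ eq 0<yz-x))
    where
    open ≈-Reasoning
    i = proj₁ (#⇒invertible y#0)
    y*i≈1 : y * i ≈ 1#
    y*i≈1 = trans (*-congʳ (sym (x-0≈x y))) (proj₂ (proj₂ (#⇒invertible y#0)))
    eq : y * z - x ≈ y * (z - x * i)
    eq = begin
      y * z - x           ≈⟨ +-congˡ (-‿cong (*-identityʳ x)) ⟨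
      y * z - x * 1#      ≈⟨ +-congˡ (-‿cong (*-congˡ y*i≈1)) ⟨
      y * z - x * (y * i) ≈⟨ solve 4 (λ x y z i → y :* z :- x :* (y :* i) := y :* (z :- x :* i)) refl x y z i ⟩
      y * (z - x * i)     ∎

  fromℕ-nonneg : ∀ n → 0# ≤ fromℕ n
  fromℕ-nonneg zero    = ≤-reflexive refl
  fromℕ-nonneg (suc n) = +-nonneg (<⇒≤ 0<1) (fromℕ-nonneg n)

  fromℕ-pos : ∀ {n} → 0 ℕ.< n → 0# < fromℕ n
  fromℕ-pos {suc n} _ = pos+nonneg 0<1 (fromℕ-nonneg n)

  -- Carries inequalities between naturals over to the reals: the difference is again a numeral,
  -- hence nonnegative, and positive when `m` is strictly below `n`.
  fromℕ-∸ : ∀ {m n} → m ℕ.≤ n → fromℕ n - fromℕ m ≈ fromℕ (n ℕ.∸ m)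
  fromℕ-∸ {m} {n} m≤n = begin
    fromℕ n - fromℕ m                     ≡⟨ ≡.cong (λ k → fromℕ k - fromℕ m) (ℕ.m∸n+n≡m m≤n) ⟨
    fromℕ (n ℕ.∸ m ℕ.+ m) - fromℕ m       ≈⟨ +-congʳ (×-homo-+ 1# (n ℕ.∸ m) m) ⟩
    fromℕ (n ℕ.∸ m) + fromℕ m - fromℕ m   ≈⟨ solve 2 (λ a b → a :+ b :- b := a) refl (fromℕ (n ℕ.∸ m)) (fromℕ m) ⟩
    fromℕ (n ℕ.∸ m)                       ∎
    where open ≈-Reasoning

  sum-nonneg : ∀ {n} {f : Vector Carrier n} → (∀ i → 0# ≤ f i) → 0# ≤ sum f
  sum-nonneg {zero}  0≤f = ≤-reflexive refl
  sum-nonneg {suc n} 0≤f = +-nonneg (0≤f zero) (sum-nonneg (0≤f ∘ suc))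

  sum-pos : ∀ {n} {f : Vector Carrier n} → (∀ i → 0# ≤ f i) → ∀ i → 0# < f i → 0# < sum f
  sum-pos 0≤f zero    0<fi = pos+nonneg 0<fi (sum-nonneg (0≤f ∘ suc))
  sum-pos 0≤f (suc i) 0<fi = <-respʳ (+-comm _ _) (pos+nonneg (sum-pos (0≤f ∘ suc) i 0<fi) (0≤f zero))

  sum-const : ∀ n x → sum {n} (λ _ → x) ≈ fromℕ n * x
  sum-const zero    x = sym (zeroˡ x)
  sum-const (suc n) x = trans (+-cong (sym (*-identityˡ x)) (sum-const n x)) (sym (distribʳ x 1# (fromℕ n)))

-- Finite sums and quadratic forms of differences.

module ℕΣ = CommutativeMonoidSum ℕ.+-0-commutativeMonoid

module QuadraticForms {c ℓ₁ ℓ₂} (R : Reals c ℓ₁ ℓ₂) where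
  open RealProperties R

  private variable
    n : ℕ

  sum-mono-≤ : {f g : Vector Carrier n} → (∀ i → f i ≤ g i) → sum f ≤ sum g
  sum-mono-≤ {zero}  f≤g = ≤-reflexive refl
  sum-mono-≤ {suc n} f≤g = +-mono-≤ (f≤g zero) (sum-mono-≤ (f≤g ∘ suc))

  sum-sub : (f g : Vector Carrier n) → sum (λ i → f i - g i) ≈ sum f - sum g
  sum-sub {zero}  f g = sym (-‿inverseʳ 0#)
  sum-sub {suc n} f g = trans (+-congˡ (sum-sub (f ∘ suc) (g ∘ suc)))
    (solve 4 (λ a b c d → a :- b :+ (c :- d) := a :+ c :- (b :+ d)) refl _ _ _ _)

  fromℕ-sum : (f : Vector ℕ n) → fromℕ (ℕΣ.sum f) ≈ sum (fromℕ ∘ f)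
  fromℕ-sum {zero}  f = refl
  fromℕ-sum {suc n} f = trans (×-homo-+ 1# (f zero) _) (+-congˡ (fromℕ-sum (f ∘ suc)))

  -- The order is not decidable, so a maximising index cannot be computed. Finitely many comparisons
  -- can nevertheless be decided under a double negation.
  ¬¬-argmax : (f : Vector Carrier (suc n)) → ¬ ¬ (∃[ s ] (∀ i → f i ≤ f s))
  ¬¬-argmax {zero}  f k = k (zero , λ { zero → ≤-reflexive refl })
  ¬¬-argmax {suc n} f k = ¬¬-argmax (f ∘ suc) λ (s , max) →
    ¬¬-excluded-middle λ where
      (yes fs<f0) → k (zero , λ { zero → ≤-reflexive refl ; (suc i) → ≤-trans (max i) (<⇒≤ fs<f0) })
      (no  f0≤fs) → k (suc s , λ { zero → f0≤fs ; (suc i) → max i })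

  -- Induction works because the decision for `suc i` and `suc j` reduces to that for `i` and `j`,
  -- so deleting the first row and column leaves a diagonal matrix.
  sum-diagonal : (t x : Vector Carrier n) → ∀ i → sum (λ j → diagonal R t i j * x j) ≈ t i * x i
  sum-diagonal {suc n} t x zero = begin
    t zero * x zero + sum (λ j → 0# * x (suc j))  ≈⟨ +-congˡ (*-distribˡ-sum 0# (x ∘ suc)) ⟨
    t zero * x zero + 0# * sum (x ∘ suc)          ≈⟨ solve 2 (λ a b → a :+ con (+ 0) :* b := a) refl _ _ ⟩
    t zero * x zero                               ∎
    where open ≈-Reasoning
  sum-diagonal {suc n} t x (suc i) =
    trans (+-cong (zeroˡ _) (sum-diagonal (t ∘ suc) (x ∘ suc) i)) (+-identityˡ _)

  ∥_∥² : Vector Carrier n → Carrier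
  ∥ x ∥² = sum (λ i → x i * x i)

  -- For symmetric `w` this is twice the quadratic form of the weighted Laplacian, because each
  -- unordered pair occurs in both orders.
  differenceForm : Matrix R n → Vector Carrier n → Carrier
  differenceForm w x = sum (λ i → sum (λ j → w i j * ((x i - x j) * (x i - x j))))

  -- Expanding the square gives two pure terms and a mixed one. Symmetry of `w` enters in `col≈row`,
  -- where exchanging the summations identifies the totals of the two pure terms.
  differenceForm-expand : (w : Matrix R n) → (∀ i j → w i j ≈ w j i) → ∀ x →
    differenceForm w x ≈
      fromℕ 2 * (sum (λ i → sum (w i) * (x i * x i)) - sum (λ i → x i * sum (λ j → w i j * x j)))
  differenceForm-expand {n} w w-sym x = begin
    sum (λ i → sum (λ j → w i j * ((x i - x j) * (x i - x j))))
      ≈⟨ sum-cong-≋ {n} (λ i → expand-row i) ⟩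
    sum (λ i → row i + (col i - fromℕ 2 * cross i))
      ≈⟨ ∑-distrib-+ {n} row _ ⟩
    sum row + sum (λ i → col i - fromℕ 2 * cross i)
      ≈⟨ +-congˡ (sum-sub {n} col _) ⟩
    sum row + (sum col - sum (λ i → fromℕ 2 * cross i))
      ≈⟨ +-congˡ (+-cong col≈row (-‿cong (sym (*-distribˡ-sum {n} (fromℕ 2) cross)))) ⟩
    sum row + (sum row - fromℕ 2 * sum cross)
      ≈⟨ solve 2 (λ a b → a :+ (a :- con (+ 2) :* b) := con (+ 2) :* (a :- b)) refl (sum row) (sum cross) ⟩
    fromℕ 2 * (sum row - sum cross) ∎
    where
    open ≈-Reasoning
    row col cross : Vector Carrier n
    row i   = sum (w i) * (x i * x i)
    col i   = sum (λ j → w i j * (x j * x j))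
    cross i = x i * sum (λ j → w i j * x j)

    expand-row : ∀ i → sum (λ j → w i j * ((x i - x j) * (x i - x j))) ≈ row i + (col i - fromℕ 2 * cross i)
    expand-row i = begin
      sum (λ j → w i j * ((x i - x j) * (x i - x j)))
        ≈⟨ sum-cong-≋ {n} (λ j → solve 3 (λ w a b → w :* ((a :- b) :* (a :- b)) :=
             w :* (a :* a) :+ (w :* (b :* b) :- con (+ 2) :* a :* (w :* b))) refl (w i j) (x i) (x j)) ⟩
      sum (λ j → w i j * (x i * x i) + (w i j * (x j * x j) - fromℕ 2 * x i * (w i j * x j)))
        ≈⟨ ∑-distrib-+ {n} _ _ ⟩
      sum (λ j → w i j * (x i * x i)) + sum (λ j → w i j * (x j * x j) - fromℕ 2 * x i * (w i j * x j))
        ≈⟨ +-cong (sym (*-distribʳ-sum {n} _ (w i))) (sum-sub {n} _ _) ⟩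
      row i + (col i - sum (λ j → fromℕ 2 * x i * (w i j * x j)))
        ≈⟨ +-congˡ (+-congˡ (-‿cong (sym (*-distribˡ-sum {n} _ _)))) ⟩
      row i + (col i - fromℕ 2 * x i * sum (λ j → w i j * x j))
        ≈⟨ +-congˡ (+-congˡ (-‿cong (*-assoc _ _ _))) ⟩
      row i + (col i - fromℕ 2 * cross i) ∎

    col≈row : sum col ≈ sum row
    col≈row = begin
      sum (λ i → sum (λ j → w i j * (x j * x j)))  ≈⟨ ∑-comm {n} {n} _ ⟩
      sum (λ j → sum (λ i → w i j * (x j * x j)))  ≈⟨ sum-cong-≋ {n} (λ j → sym (*-distribʳ-sum {n} _ (λ i → w i j))) ⟩
      sum (λ j → sum (λ i → w i j) * (x j * x j))  ≈⟨ sum-cong-≋ {n} (λ j → *-congʳ (sum-cong-≋ {n} (λ i → w-sym i j))) ⟩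
      sum row                                      ∎

  -- As weights of a difference form these describe the complete graph, since the differences on the
  -- diagonal are zero.
  uniform : Matrix R n
  uniform _ _ = 1#

  uniform-expand : (x : Vector Carrier n) →
    differenceForm uniform x ≈ fromℕ 2 * (fromℕ n * ∥ x ∥² - sum x * sum x)
  uniform-expand {n} x = trans (differenceForm-expand uniform (λ _ _ → refl) x)
    (*-congˡ (+-cong norm (-‿cong cross)))
    where
    norm : sum (λ i → sum {n} (λ _ → 1#) * (x i * x i)) ≈ fromℕ n * ∥ x ∥²
    norm = trans (sym (*-distribˡ-sum {n} _ _)) (*-congʳ (trans (sum-const n 1#) (*-identityʳ _)))
    cross : sum (λ i → x i * sum (λ j → 1# * x j)) ≈ sum x * sum x
    cross = trans (sym (*-distribʳ-sum {n} _ x)) (*-congˡ (sum-cong-≋ {n} (λ j → *-identityˡ (x j))))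

  differenceForm-nonneg : (w : Matrix R n) → (∀ i j → 0# ≤ w i j) → ∀ x → 0# ≤ differenceForm w x
  differenceForm-nonneg {n} w 0≤w x = sum-nonneg {n} (λ i → sum-nonneg {n} (λ j → *-nonneg (0≤w i j) (square-nonneg _)))

  -- 4 (right − left) is the value of the form at the vector 2x − (x_s − x_t)(1_s − 1_t).
  uniform-lower : (x : Vector Carrier n) → ∀ s t →
    fromℕ n * ((x s - x t) * (x s - x t)) ≤ differenceForm uniform x
  uniform-lower {n} x s t = 0≤y-x⇒x≤y (*-cancelˡ-nonneg {fromℕ 4} (fromℕ-pos {4} ℕ.z<s)
    (≤-respʳ form-z (differenceForm-nonneg uniform (λ _ _ → <⇒≤ 0<1) z)))
    where
    open ≈-Reasoning
    e : Fin n → Vector Carrier n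
    e = diagonal R (λ _ → 1#)
    ψ z : Vector Carrier n
    ψ i = e s i - e t i
    δ = x s - x t
    z i = fromℕ 2 * x i - δ * ψ i

    ψ∙ : ∀ y → sum (λ i → ψ i * y i) ≈ y s - y t
    ψ∙ y = begin
      sum (λ i → ψ i * y i)                 ≈⟨ sum-cong-≋ {n} (λ i → solve 3 (λ a b y → (a :- b) :* y := a :* y :- b :* y) refl (e s i) (e t i) (y i)) ⟩
      sum (λ i → e s i * y i - e t i * y i) ≈⟨ sum-sub {n} _ _ ⟩
      sum (λ i → e s i * y i) - sum (λ i → e t i * y i)
        ≈⟨ +-cong (trans (sum-diagonal _ y s) (*-identityˡ _)) (-‿cong (trans (sum-diagonal _ y t) (*-identityˡ _))) ⟩
      y s - y t ∎

    e-diag : ∀ i → e i i ≈ 1#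
    e-diag i rewrite dec-true (i Fin.≟ i) ≡.refl = refl

    e-off : ∀ {i j} → i ≢ j → e i j ≈ 0#
    e-off {i} {j} i≢j rewrite dec-false (i Fin.≟ j) i≢j = refl

    -- For s ≠ t the norm of `ψ` is 2, but for s = t it is 0. The factor δ², which is zero in the
    -- second case, makes one identity cover both.
    δδ∥ψ∥² : δ * δ * ∥ ψ ∥² ≈ fromℕ 2 * (δ * δ)
    δδ∥ψ∥² with s Fin.≟ t
    ... | yes ≡.refl = solve 2 (λ a p → (a :- a) :* (a :- a) :* p := con (+ 2) :* ((a :- a) :* (a :- a))) refl (x s) ∥ ψ ∥²
    ... | no s≢t = begin
      δ * δ * ∥ ψ ∥²           ≈⟨ *-congˡ (ψ∙ ψ) ⟩
      δ * δ * (e s s - e t s - (e s t - e t t))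
        ≈⟨ *-congˡ (+-cong (+-cong (e-diag s) (-‿cong (e-off (s≢t ∘ ≡.sym)))) (-‿cong (+-cong (e-off s≢t) (-‿cong (e-diag t))))) ⟩
      δ * δ * (1# - 0# - (0# - 1#))
        -- In the solver `con (+ 1)` denotes `1# + 0#`, so `1#` is passed as the variable `i` and
        -- `fromℕ 2` appears unfolded.
        ≈⟨ solve 2 (λ d i → d :* d :* (i :- con (+ 0) :- (con (+ 0) :- i)) := (i :+ (i :+ con (+ 0))) :* (d :* d)) refl δ 1# ⟩
      fromℕ 2 * (δ * δ)        ∎

    sum-z : sum z ≈ fromℕ 2 * sum x
    sum-z = begin
      sum z ≈⟨ sum-sub {n} _ _ ⟩
      sum (λ i → fromℕ 2 * x i) - sum (λ i → δ * ψ i)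
        ≈⟨ +-cong (sym (*-distribˡ-sum {n} _ x)) (-‿cong (sym (*-distribˡ-sum {n} δ ψ))) ⟩
      fromℕ 2 * sum x - δ * sum ψ
        ≈⟨ +-congˡ (-‿cong (*-congˡ (trans (sum-cong-≋ {n} (λ i → sym (*-identityʳ (ψ i)))) (ψ∙ (λ _ → 1#))))) ⟩
      fromℕ 2 * sum x - δ * (1# - 1#)
        ≈⟨ solve 3 (λ a d i → a :- d :* (i :- i) := a) refl (fromℕ 2 * sum x) δ 1# ⟩
      fromℕ 2 * sum x ∎

    norm-z : ∥ z ∥² ≈ fromℕ 4 * ∥ x ∥² - fromℕ 2 * (δ * δ)
    norm-z = begin
      ∥ z ∥²
        ≈⟨ sum-cong-≋ {n} (λ i → solve 3 (λ x d p → (con (+ 2) :* x :- d :* p) :* (con (+ 2) :* x :- d :* p)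
             := con (+ 4) :* (x :* x) :- con (+ 4) :* d :* (p :* x) :+ d :* d :* (p :* p)) refl (x i) δ (ψ i)) ⟩
      sum (λ i → fromℕ 4 * (x i * x i) - fromℕ 4 * δ * (ψ i * x i) + δ * δ * (ψ i * ψ i))
        ≈⟨ ∑-distrib-+ {n} _ _ ⟩
      sum (λ i → fromℕ 4 * (x i * x i) - fromℕ 4 * δ * (ψ i * x i)) + sum (λ i → δ * δ * (ψ i * ψ i))
        ≈⟨ +-cong (sum-sub {n} _ _) (sym (*-distribˡ-sum {n} _ _)) ⟩
      sum (λ i → fromℕ 4 * (x i * x i)) - sum (λ i → fromℕ 4 * δ * (ψ i * x i)) + δ * δ * ∥ ψ ∥²
        ≈⟨ +-cong (+-cong (sym (*-distribˡ-sum {n} _ _)) (-‿cong (trans (sym (*-distribˡ-sum {n} _ _)) (*-congˡ (ψ∙ x))))) δδ∥ψ∥² ⟩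
      fromℕ 4 * ∥ x ∥² - fromℕ 4 * δ * δ + fromℕ 2 * (δ * δ)
        ≈⟨ solve 2 (λ a d → a :- con (+ 4) :* d :* d :+ con (+ 2) :* (d :* d) := a :- con (+ 2) :* (d :* d)) refl (fromℕ 4 * ∥ x ∥²) δ ⟩
      fromℕ 4 * ∥ x ∥² - fromℕ 2 * (δ * δ) ∎

    form-z : differenceForm uniform z ≈ fromℕ 4 * (differenceForm uniform x - fromℕ n * (δ * δ))
    form-z = begin
      differenceForm uniform z
        ≈⟨ uniform-expand z ⟩
      fromℕ 2 * (fromℕ n * ∥ z ∥² - sum z * sum z)
        ≈⟨ *-congˡ (+-cong (*-congˡ norm-z) (-‿cong (*-cong sum-z sum-z))) ⟩
      fromℕ 2 * (fromℕ n * (fromℕ 4 * ∥ x ∥² - fromℕ 2 * (δ * δ)) - fromℕ 2 * sum x * (fromℕ 2 * sum x))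
        ≈⟨ solve 4 (λ n a d b → con (+ 2) :* (n :* (con (+ 4) :* a :- con (+ 2) :* (d :* d)) :- con (+ 2) :* b :* (con (+ 2) :* b))
             := con (+ 4) :* (con (+ 2) :* (n :* a :- b :* b) :- n :* (d :* d))) refl (fromℕ n) ∥ x ∥² δ (sum x) ⟩
      fromℕ 4 * (fromℕ 2 * (fromℕ n * ∥ x ∥² - sum x * sum x) - fromℕ n * (δ * δ))
        ≈⟨ *-congˡ (+-congʳ (uniform-expand x)) ⟨
      fromℕ 4 * (differenceForm uniform x - fromℕ n * (δ * δ)) ∎

-- The algebraic inequality behind the spectral gap.

module GapInequality {c ℓ₁ ℓ₂} (R : Reals c ℓ₁ ℓ₂) where
  open RealProperties R
  open QuadraticForms R

  -- Weighted Cauchy-Schwarz with denominators cleared: the difference of the two sides is the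
  -- square of Cδ - Amq. It quantifies that q and δ can be small together only if q + mδ is.
  completed-square : ∀ A C m q δ →
    A * C * ((q + m * δ) * (q + m * δ)) ≤ (C + A * (m * m)) * (A * (q * q) + C * (δ * δ))
  completed-square A C m q δ = 0≤y-x⇒x≤y (≤-respʳ
    (solve 5 (λ A C m q δ → (C :* δ :- A :* m :* q) :* (C :* δ :- A :* m :* q) :=
      (C :+ A :* (m :* m)) :* (A :* (q :* q) :+ C :* (δ :* δ)) :- A :* C :* ((q :+ m :* δ) :* (q :+ m :* δ)))
      refl A C m q δ)
    (square-nonneg (C * δ - A * m * q)))

  -- For A = 2σ, K = nT - 2σ and f = (1 - α)n this is the denominator of the theorem: A + K = nT
  -- turns f(A + K) + 2AK into (1 - α)n²T + 4σK.
  denominator : (A K f : Carrier) → Carrier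
  denominator A K f = A * (f + fromℕ 2 * K) + f * K

  module _ {A K f : Carrier} (A-pos : 0# < A) (K-pos : 0# < K) (f-pos : 0# < f) where
    -- `C` is the coefficient of (b - y)² in the excess. With q = my - fb the combination q + m(b -
    -- y) equals 2Kb, free of y; this explains `Z`, while `M` is the factor from `completed-square`.
    C m M Z den : Carrier
    C   = f * f * K
    m   = fromℕ 2 * K + f
    M   = C + A * (m * m)
    Z   = A * C * (fromℕ 4 * (K * K))
    den = denominator A K f

    private
      2-pos : 0# < fromℕ 2
      2-pos = fromℕ-pos {2} ℕ.z<s

      C-pos : 0# < C
      C-pos = *-pos (*-pos f-pos f-pos) K-pos

      M-pos : 0# < M
      M-pos = pos+nonneg C-pos (*-nonneg (<⇒≤ A-pos) (square-nonneg m))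

      Z-pos : 0# < Z
      Z-pos = *-pos (*-pos A-pos C-pos) (*-pos (fromℕ-pos {4} ℕ.z<s) (*-pos K-pos K-pos))

    denominator-pos : 0# < den
    denominator-pos = +-pos (*-pos A-pos (+-pos f-pos (*-pos 2-pos K-pos))) (*-pos f-pos K-pos)

    -- In the bracket after `M`, the coefficients of Q, E and P are 2A(f + 2K), `den` and -2fK, so
    -- inserting the three estimates can only decrease it. What is left is Aq² + C(b - y)², to which
    -- `completed-square` applies.
    quadratic-bound : ∀ {Q P E} b y →
      K * (y * y) ≤ Q → f * ((b - y) * (b - y)) ≤ E → P ≤ A * (b * b) →
      Z * (b * b) ≤ M * (den * (fromℕ 2 * Q + E) - fromℕ 2 * (f * K) * (Q + P))
    quadratic-bound {Q} {P} {E} b y Ky²≤Q fδ²≤E P≤Ab² = ≤-trans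
      (≤-respˡ ZbbEq (completed-square A C m q δ))
      (*-monoˡ-≤ (<⇒≤ M-pos) (0≤y-x⇒x≤y (≤-respʳ decomposition rest-nonneg)))
      where
      δ = b - y
      q = m * y - f * b

      ZbbEq : A * C * ((q + m * δ) * (q + m * δ)) ≈ Z * (b * b)
      ZbbEq = solve 5 (λ AC K f b y →
        let m = con (+ 2) :* K :+ f ; r = m :* y :- f :* b :+ m :* (b :- y) in
        AC :* (r :* r) := AC :* (con (+ 4) :* (K :* K)) :* (b :* b)) refl (A * C) K f b y

      rest-nonneg : 0# ≤ fromℕ 2 * A * (f + fromℕ 2 * K) * (Q - K * (y * y))
                       + den * (E - f * (δ * δ))
                       + fromℕ 2 * (f * K) * (A * (b * b) - P)
      rest-nonneg = +-nonneg (+-nonneg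
        (*-nonneg (<⇒≤ (*-pos (*-pos 2-pos A-pos) (+-pos f-pos (*-pos 2-pos K-pos)))) (x≤y⇒0≤y-x Ky²≤Q))
        (*-nonneg (<⇒≤ denominator-pos) (x≤y⇒0≤y-x fδ²≤E)))
        (*-nonneg (<⇒≤ (*-pos 2-pos (*-pos f-pos K-pos))) (x≤y⇒0≤y-x P≤Ab²))

      -- At equality in all three estimates the part of the bracket beyond C(b - y)² is A times m²y²
      -- - 2mfby + f²b², which is Aq².
      decomposition :
        fromℕ 2 * A * (f + fromℕ 2 * K) * (Q - K * (y * y))
          + den * (E - f * (δ * δ))
          + fromℕ 2 * (f * K) * (A * (b * b) - P)
        ≈ den * (fromℕ 2 * Q + E) - fromℕ 2 * (f * K) * (Q + P) - (A * (q * q) + C * (δ * δ))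
      decomposition = solve 8 (λ A K f Q P E b y →
        let 2c = con (+ 2)
            den = A :* (f :+ 2c :* K) :+ f :* K
            δ = b :- y
            q = (2c :* K :+ f) :* y :- f :* b
        in
        2c :* A :* (f :+ 2c :* K) :* (Q :- K :* (y :* y))
          :+ den :* (E :- f :* (δ :* δ))
          :+ 2c :* (f :* K) :* (A :* (b :* b) :- P)
        := den :* (2c :* Q :+ E) :- 2c :* (f :* K) :* (Q :+ P) :- (A :* (q :* q) :+ f :* f :* K :* (δ :* δ)))
        refl A K f Q P E b y

    -- The bound Z X involves neither b nor y, so it can be derived, as a negation, from their
    -- double-negated existence. Its positivity and the cancellation of positive factors then give
    -- strictness.
    spectral-gap : ∀ {N T μ X Q P E} → 0# < N → 0# < X →
      fromℕ 2 * ((T - μ) * X) ≈ fromℕ 2 * Q + E → T * X ≈ Q + P →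
      ¬ ¬ (Σ[ b ∈ Carrier ] Σ[ y ∈ Carrier ]
        K * (y * y) ≤ Q × f * ((b - y) * (b - y)) ≤ E × P ≤ A * (b * b) × X ≤ N * (b * b)) →
      0# < den * (T - μ) - f * K * T
    spectral-gap {N} {T} {μ} {X} {Q} {P} {E} 0<N 0<X 2[T-μ]X≈ TX≈ bounds =
      *-cancelˡ-pos (*-pos (*-pos 0<N M-pos) (*-pos 2-pos 0<X))
        (<-≤-trans (*-pos Z-pos 0<X) ZX≤)
      where
      Y = den * (fromℕ 2 * Q + E) - fromℕ 2 * (f * K) * (Q + P)

      Y≈ : N * (M * Y) ≈ N * M * (fromℕ 2 * X) * (den * (T - μ) - f * K * T)
      Y≈ = trans (*-congˡ (*-congˡ (+-cong (*-congˡ (sym 2[T-μ]X≈)) (-‿cong (*-congˡ (sym TX≈))))))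
        (solve 7 (λ N M d g T u X →
          N :* (M :* (d :* (con (+ 2) :* ((T :- u) :* X)) :- con (+ 2) :* g :* (T :* X))) :=
          N :* M :* (con (+ 2) :* X) :* (d :* (T :- u) :- g :* T)) refl N M den (f * K) T μ X)

      ZX≤ : Z * X ≤ N * M * (fromℕ 2 * X) * (den * (T - μ) - f * K * T)
      ZX≤ lt = bounds λ (b , y , Ky²≤Q , fδ²≤E , P≤Ab² , X≤Nb²) →
        ≤-trans (*-monoˡ-≤ (<⇒≤ Z-pos) X≤Nb²)
          (≤-respˡ (solve 3 (λ N Z b → N :* (Z :* (b :* b)) := Z :* (N :* (b :* b))) refl N Z b)
          (≤-respʳ Y≈ (*-monoˡ-≤ (<⇒≤ 0<N) (quadratic-bound b y Ky²≤Q fδ²≤E P≤Ab²)))) lt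

-- Transmissions and distances as natural numbers.

lookup≤foldr-⊔ : ∀ {n} (f : Vector ℕ n) i → f i ℕ.≤ foldr ℕ._⊔_ 0 f
lookup≤foldr-⊔ f zero    = ℕ.m≤m⊔n (f zero) _
lookup≤foldr-⊔ f (suc i) = ℕ.≤-trans (lookup≤foldr-⊔ (f ∘ suc) i) (ℕ.m≤n⊔m (f zero) _)

module GraphTransmission {n} (G : Graph n) (conn : Connected G) where

  dist-pos : ∀ {u v} → u ≢ v → 0 ℕ.< dist G conn u v
  dist-pos {u} {v} u≢v with dist G conn u v | dist-isLeast G conn u v
  ... | zero  | [] , _ = contradiction ≡.refl u≢v
  ... | suc _ | _      = ℕ.z<s

  transmission≤Tmax : ∀ u → transmission G conn u ℕ.≤ Tmax G conn
  transmission≤Tmax = lookup≤foldr-⊔ (transmission G conn)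

  module _ (irregular : ¬ TransmissionRegular G conn) where

    -- Transmissions are naturals and vertices are finitely many, so the search is decidable; if it
    -- failed, all transmissions would equal the maximum. The witness makes nT - 2σ positive.
    ∃transmission<Tmax : ∃[ u ] transmission G conn u ℕ.< Tmax G conn
    ∃transmission<Tmax with Fin.any? (λ u → transmission G conn u ℕ.<? Tmax G conn)
    ... | yes ∃u = ∃u
    ... | no ∄u  = contradiction (λ u v → ≡.trans (T≡ u) (≡.sym (T≡ v))) irregular
      where
      T≡ : ∀ u → transmission G conn u ≡ Tmax G conn
      T≡ u = ℕ.≤-antisym (transmission≤Tmax u) (ℕ.≮⇒≥ (λ lt → ∄u (u , lt)))

    -- If all transmissions vanished they would be equal. The witness makes 2σ positive.
    ∃transmission>0 : ∃[ u ] 0 ℕ.< transmission G conn u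
    ∃transmission>0 with Fin.any? (λ u → 0 ℕ.<? transmission G conn u)
    ... | yes ∃u = ∃u
    ... | no ∄u  = contradiction (λ u v → ≡.trans (T≡0 u) (≡.sym (T≡0 v))) irregular
      where
      T≡0 : ∀ u → transmission G conn u ≡ 0
      T≡0 u = ℕ.n≤0⇒n≡0 (ℕ.≮⇒≥ (λ lt → ∄u (u , lt)))

-- Quadratic forms of the distance matrix.

module DistanceSpectrum {c ℓ₁ ℓ₂} (R : Reals c ℓ₁ ℓ₂) {n} (G : Graph n) (conn : Connected G) where
  open RealProperties R
  open QuadraticForms R
  open GapInequality R
  open GraphTransmission G conn
  open ≈-Reasoning

  N T S A K : Carrier
  N = fromℕ n
  T = fromℕ (Tmax G conn)
  S = fromℕ (σ G conn)
  A = fromℕ 2 * S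
  K = N * T - A

  τ : Vector Carrier n
  τ u = fromℕ (transmission G conn u)

  d : Matrix R n
  d = distanceMatrix R G conn

  d-rowSum : ∀ u → sum (d u) ≈ τ u
  d-rowSum u = sym (fromℕ-sum (dist G conn u))

  τ-sum : sum τ ≈ A
  τ-sum = begin
    sum τ                                ≈⟨ fromℕ-sum (transmission G conn) ⟨
    fromℕ (ℕΣ.sum (transmission G conn)) ≡⟨ ≡.cong fromℕ (σ+σ≡∑transmission G conn) ⟨
    fromℕ (σ G conn ℕ.+ σ G conn)        ≈⟨ ×-homo-+ 1# (σ G conn) (σ G conn) ⟩
    S + S                                ≈⟨ solve 1 (λ s → s :+ s := con (+ 2) :* s) refl S ⟩
    A                                    ∎

  deficit-sum : sum (λ u → T - τ u) ≈ K
  deficit-sum = trans (sum-sub {n} (λ _ → T) τ) (+-cong (sum-const n T) (-‿cong τ-sum))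

  deficit-nonneg : ∀ u → 0# ≤ T - τ u
  deficit-nonneg u = ≤-respʳ (sym (fromℕ-∸ (transmission≤Tmax u))) (fromℕ-nonneg (Tmax G conn ℕ.∸ transmission G conn u))

  module _ (irregular : ¬ TransmissionRegular G conn) where

    A-pos : 0# < A
    A-pos with ∃transmission>0 irregular
    ... | u , 0<Tu = <-respʳ τ-sum (sum-pos {n} (λ v → fromℕ-nonneg (transmission G conn v)) u (fromℕ-pos 0<Tu))

    K-pos : 0# < K
    K-pos with ∃transmission<Tmax irregular
    ... | u , Tu<T = <-respʳ deficit-sum (sum-pos {n} deficit-nonneg u
      (<-respʳ (sym (fromℕ-∸ (transmission≤Tmax u))) (fromℕ-pos (ℕ.m<n⇒0<n∸m Tu<T))))

  -- Distinct vertices are at distance at least 1, and on the diagonal both summands vanish.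
  differenceForm-d-lower : ∀ x → differenceForm uniform x ≤ differenceForm d x
  differenceForm-d-lower x = sum-mono-≤ {n} (λ u → sum-mono-≤ {n} (λ v → entry u v))
    where
    entry : ∀ u v → 1# * ((x u - x v) * (x u - x v)) ≤ d u v * ((x u - x v) * (x u - x v))
    entry u v with u Fin.≟ v
    ... | yes ≡.refl = ≤-reflexive (solve 3 (λ i d a → i :* ((a :- a) :* (a :- a)) := d :* ((a :- a) :* (a :- a))) refl 1# (d u u) (x u))
    ... | no u≢v = *-monoʳ-≤ (square-nonneg _) (≤-respˡ (+-identityʳ 1#)
      (0≤y-x⇒x≤y (≤-respʳ (sym (fromℕ-∸ (dist-pos u≢v))) (fromℕ-nonneg (dist G conn u v ℕ.∸ 1)))))

  module _ (x : Vector Carrier n) where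

    -- `deficit` and `weighted` are the quantities Q and P; `cross` is the quadratic form of the
    -- distance matrix.
    weighted deficit cross : Carrier
    weighted = sum (λ u → τ u * (x u * x u))
    deficit  = sum (λ u → (T - τ u) * (x u * x u))
    cross    = sum (λ u → x u * sum (λ v → d u v * x v))

    T∥x∥² : T * ∥ x ∥² ≈ deficit + weighted
    T∥x∥² = begin
      T * ∥ x ∥²                    ≈⟨ *-distribˡ-sum {n} T _ ⟩
      sum (λ u → T * (x u * x u))   ≈⟨ sum-cong-≋ {n} (λ u → solve 3 (λ T t s → T :* s := (T :- t) :* s :+ t :* s) refl T (τ u) (x u * x u)) ⟩
      sum (λ u → (T - τ u) * (x u * x u) + τ u * (x u * x u)) ≈⟨ ∑-distrib-+ {n} _ _ ⟩
      deficit + weighted            ∎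

    -- The row sums of the distance matrix are the transmissions, so its difference form is twice
    -- the form of the distance Laplacian T(G) - D(G).
    differenceForm-d : differenceForm d x ≈ fromℕ 2 * (weighted - cross)
    differenceForm-d = trans (differenceForm-expand d (λ u v → reflexive (≡.cong fromℕ (dist-sym G conn u v))) x)
      (*-congˡ (+-congʳ (sum-cong-≋ {n} (λ u → *-congʳ (d-rowSum u)))))

    module _ (α μ : Carrier) (eigen : ∀ u → sum (λ v → D[_] R G conn α u v * x v) ≈ μ * x u) where

      -- The eigenvalue equation is paired with the vector: row `u` is multiplied by `x u` and the
      -- rows are added.
      μ∥x∥² : μ * ∥ x ∥² ≈ α * weighted + (1# - α) * cross
      μ∥x∥² = begin
        μ * ∥ x ∥²  ≈⟨ *-distribˡ-sum {n} μ _ ⟩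
        sum (λ u → μ * (x u * x u)) ≈⟨ sum-cong-≋ {n} row ⟩
        sum (λ u → α * (τ u * (x u * x u)) + (1# - α) * (x u * sum (λ v → d u v * x v))) ≈⟨ ∑-distrib-+ {n} _ _ ⟩
        sum (λ u → α * (τ u * (x u * x u))) + sum (λ u → (1# - α) * (x u * sum (λ v → d u v * x v)))
          ≈⟨ +-cong (*-distribˡ-sum {n} α _) (*-distribˡ-sum {n} (1# - α) _) ⟨
        α * weighted + (1# - α) * cross ∎
        where
        row : ∀ u → μ * (x u * x u) ≈ α * (τ u * (x u * x u)) + (1# - α) * (x u * sum (λ v → d u v * x v))
        row u = begin
          μ * (x u * x u)  ≈⟨ *-assoc μ _ _ ⟨
          μ * x u * x u    ≈⟨ *-congʳ (eigen u) ⟨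
          sum (λ v → D[_] R G conn α u v * x v) * x u
            ≈⟨ *-congʳ (sum-cong-≋ {n} (λ v → solve 5 (λ a t b d x → (a :* t :+ b :* d) :* x := a :* (t :* x) :+ b :* (d :* x)) refl α _ (1# - α) _ (x v))) ⟩
          sum (λ v → α * (transmissionMatrix R G conn u v * x v) + (1# - α) * (d u v * x v)) * x u
            ≈⟨ *-congʳ (∑-distrib-+ {n} _ _) ⟩
          (sum (λ v → α * (transmissionMatrix R G conn u v * x v)) + sum (λ v → (1# - α) * (d u v * x v))) * x u
            ≈⟨ *-congʳ (+-cong (*-distribˡ-sum {n} α _) (*-distribˡ-sum {n} (1# - α) _)) ⟨
          (α * sum (λ v → transmissionMatrix R G conn u v * x v) + (1# - α) * sum (λ v → d u v * x v)) * x u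
            ≈⟨ *-congʳ (+-congʳ (*-congˡ (sum-diagonal τ x u))) ⟩
          (α * (τ u * x u) + (1# - α) * sum (λ v → d u v * x v)) * x u
            ≈⟨ solve 5 (λ a t x b s → (a :* (t :* x) :+ b :* s) :* x := a :* (t :* (x :* x)) :+ b :* (x :* s)) refl α (τ u) (x u) (1# - α) _ ⟩
          α * (τ u * (x u * x u)) + (1# - α) * (x u * sum (λ v → d u v * x v)) ∎

      -- This is the quadratic form of the splitting T_max I - D_α = (T_max I - T(G)) + (1 - α)(T(G)
      -- - D(G)).
      2[T-μ]∥x∥² : fromℕ 2 * ((T - μ) * ∥ x ∥²) ≈ fromℕ 2 * deficit + (1# - α) * differenceForm d x
      2[T-μ]∥x∥² = begin
        fromℕ 2 * ((T - μ) * ∥ x ∥²)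
          ≈⟨ *-congˡ (solve 3 (λ T u X → (T :- u) :* X := T :* X :- u :* X) refl T μ ∥ x ∥²) ⟩
        fromℕ 2 * (T * ∥ x ∥² - μ * ∥ x ∥²)
          ≈⟨ *-congˡ (+-cong T∥x∥² (-‿cong μ∥x∥²)) ⟩
        fromℕ 2 * (deficit + weighted - (α * weighted + (1# - α) * cross))
          -- Since `1#` is a variable for the solver, its role as coefficient of `weighted` has to
          -- be made explicit first.
          ≈⟨ *-congˡ (+-congʳ (+-congˡ (*-identityˡ weighted))) ⟨
        fromℕ 2 * (deficit + 1# * weighted - (α * weighted + (1# - α) * cross))
          ≈⟨ solve 5 (λ i a q w c → con (+ 2) :* (q :+ i :* w :- (a :* w :+ (i :- a) :* c)) :=
               con (+ 2) :* q :+ (i :- a) :* (con (+ 2) :* (w :- c))) refl 1# α deficit weighted cross ⟩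
        fromℕ 2 * deficit + (1# - α) * (fromℕ 2 * (weighted - cross))
          ≈⟨ +-congˡ (*-congˡ differenceForm-d) ⟨
        fromℕ 2 * deficit + (1# - α) * differenceForm d x ∎

    module _ {s t} (max : ∀ u → x u * x u ≤ x s * x s) (min : ∀ u → x t * x t ≤ x u * x u) where

      -- The weights T - T_u are nonnegative with sum `K`, so every square may be replaced by the
      -- smallest one.
      deficit-lower : K * (x t * x t) ≤ deficit
      deficit-lower = ≤-respˡ (trans (sym (*-distribʳ-sum {n} _ _)) (*-congʳ deficit-sum))
        (sum-mono-≤ {n} (λ u → *-monoˡ-≤ (deficit-nonneg u) (min u)))

      weighted-upper : weighted ≤ A * (x s * x s)
      weighted-upper = ≤-respʳ (trans (sym (*-distribʳ-sum {n} _ τ)) (*-congʳ τ-sum))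
        (sum-mono-≤ {n} (λ u → *-monoˡ-≤ (fromℕ-nonneg (transmission G conn u)) (max u)))

      norm-upper : ∥ x ∥² ≤ N * (x s * x s)
      norm-upper = ≤-respʳ (sum-const n _) (sum-mono-≤ {n} max)

-- The bound for the distance α-spectral radius.

theorem3p5 :
    ∀ {c ℓ₁ ℓ₂} (R : Reals c ℓ₁ ℓ₂) → let open Reals R in
    (α : Carrier) → 0# ≤ α → α < 1# →
    (n : ℕ) (G : Graph n) (conn : Connected G) →
    ¬ TransmissionRegular G conn →
    (μ : Carrier) → IsSpectralRadius R G conn α μ →
    let N   = fromℕ n
        T   = fromℕ (Tmax G conn)
        S   = fromℕ (σ G conn)
        num = (1# - α) * N * T * (N * T - fromℕ 2 * S)
        den = (1# - α) * (N * N) * T + fromℕ 4 * S * (N * T - fromℕ 2 * S)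
    in Σ[ den#0 ∈ den # 0# ] (divide num den den#0 < T - μ)
theorem3p5 R α _ α<1 (suc n) G conn irregular μ ((x , (i , xi#0) , eigen) , _) =
  inj₂ 0<den , divide-< _ _ (inj₂ 0<den) 0<den (T - μ) (<-respʳ scaled≈ gap)
  where
  open RealProperties R
  open QuadraticForms R
  open GapInequality R
  open DistanceSpectrum R G conn

  a f : Carrier
  a = 1# - α
  -- The coefficient of (b - y)² in the lower bound for (1 - α)E: the complete graph supplies n, the
  -- matrix D_α the factor 1 - α.
  f = a * N

  a-pos : 0# < a
  a-pos = x<y⇒0<y-x α<1

  N-pos : 0# < N
  N-pos = fromℕ-pos {suc n} ℕ.z<s

  f-pos : 0# < f
  f-pos = *-pos a-pos N-pos

  den≈ : denominator A K f ≈ a * (N * N) * T + fromℕ 4 * S * K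
  den≈ = solve 4 (λ a N T S →
    let A = con (+ 2) :* S ; K = N :* T :- A ; f = a :* N in
    A :* (f :+ con (+ 2) :* K) :+ f :* K := a :* (N :* N) :* T :+ con (+ 4) :* S :* K) refl a N T S

  0<den : 0# < a * (N * N) * T + fromℕ 4 * S * K
  0<den = <-respʳ den≈ (denominator-pos (A-pos irregular) (K-pos irregular) f-pos)

  scaled≈ : denominator A K f * (T - μ) - f * K * T ≈
            (a * (N * N) * T + fromℕ 4 * S * K) * (T - μ) - a * N * T * K
  scaled≈ = +-cong (*-congʳ den≈) (-‿cong (solve 3 (λ f K T → f :* K :* T := f :* T :* K) refl f K T))

  gap : 0# < denominator A K f * (T - μ) - f * K * T
  gap = spectral-gap (A-pos irregular) (K-pos irregular) f-pos N-pos
    (sum-pos {suc n} (λ u → square-nonneg (x u)) i (#⇒square-pos xi#0))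
    (2[T-μ]∥x∥² x α μ eigen) (T∥x∥² x)
    λ k → ¬¬-argmax (λ u → x u * x u) λ (s , max) →
          -- A smallest square is found as a largest negated square.
          ¬¬-argmax (λ u → - (x u * x u)) λ (t , -max) →
    let min = λ u → 0≤y-x⇒x≤y (≤-respʳ
                (solve 2 (λ p q → :- p :- :- q := q :- p) refl (x t * x t) (x u * x u)) (x≤y⇒0≤y-x (-max u)))
        -- The complete graph bounds the spread between `x s` and `x t`, the distances dominate its
        -- weights, and the factor 1 - α is carried along.
        spread = ≤-respˡ (sym (*-assoc a N _))
          (*-monoˡ-≤ (<⇒≤ a-pos) (≤-trans (uniform-lower x s t) (differenceForm-d-lower x)))
    in k (x s , x t , deficit-lower x {s} {t} max min , spread ,
          weighted-upper x {s} {t} max min , norm-upper x {s} {t} max min)
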